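{- For a finite simple graph $G$ the following statements are equivalent: (1) $G$ admits a $\{{}^rP_3, {}^bP_3, {}^{rrb}K_3, {}^{rbb}K_3\}$-free $2$-edge-colouring. (2) $G$ is the line graph of a bipartite graph. (3) $G$ is a $\{\text{claw}, \text{diamond}, \text{odd-hole}\}$-free graph.
   Context: Graphs are finite and simple. A $2$-edge-colouring of $G$ assigns to every edge the colour red or blue (not necessarily properly). For a set $\mathcal F$ of $2$-edge-coloured graphs, a $2$-edge-colouring of $G$ is $\mathcal F$-free if no induced $2$-edge-coloured subgraph is isomorphic (preserving colours) to a member of $\mathcal F$. Patterns on three vertices: ${}^rP_3$ (resp. ${}^bP_3$) is the path on three vertices with both edges red (resp. blue); ${}^{rrb}K_3$ is the triangle with two red edges and one blue edge; ${}^{rbb}K_3$ is the triangle with one red edge and two blue edges. The line graph of $H$ has vertex set $E(H)$, two vertices being adjacent iff the corresponding edges share an endpoint. For uncoloured graphs, being free of a set of graphs means containing no induced subgraph isomorphic to a member. The claw is $K_{1,3}$; the diamond is $K_4$ minus one edge; an odd-hole is a chordless cycle of odd length at least $5$. -}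

module Defs where

open import Data.Bool.Base using (Bool; _∨_; if_then_else_)
open import Data.Bool.Properties using (∨-comm)
open import Data.Fin.Base using (Fin; toℕ; _<_)
open import Data.Fin.Patterns using (0F; 1F; 2F; 3F)
open import Data.Fin.Properties using (_≟_; any?)
open import Data.Fin.Subset using (Subset; _∈_)
open import Data.List.Base using (List; []; _∷_)
open import Data.Nat.Base using (ℕ; suc; _≤_; _%_)
import Data.Nat.Properties as ℕ
open import Data.Product.Base using (Σ; ∃; _×_; _,_; proj₁; proj₂; swap)
open import Data.Product.Properties using (≡-dec)
open import Data.Sum.Base using (_⊎_; inj₁; inj₂)
open import Function.Bundles using (_⇔_; _↔_; module Equivalence; module Inverse)
open import Level using (0ℓ)
open import Relation.Binary.Construct.Closure.Symmetric using (SymClosure; fwd; bwd; symmetric)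
open import Relation.Binary.Core using (Rel)
open import Relation.Binary.Definitions using (Decidable; DecidableEquality; Irreflexive; Symmetric)
open import Relation.Binary.PropositionalEquality using (_≡_; _≢_; refl; sym; cong)
open import Relation.Nullary.Decidable using (Dec; does; ¬?; map′; _×-dec_; _⊎-dec_)
open import Relation.Nullary.Negation using (¬_)

import Data.List.Membership.DecPropositional as DecMembership
import Data.List.Membership.Propositional as List

------------------------------------------------------------------------
-- Simple graphs

record Graph (V : Set) : Set₁ where
  infix 4 _~_ _~?_
  field
    _~_      : Rel V 0ℓ
    _~?_     : Decidable _~_
    ~-sym    : Symmetric _~_
    ~-irrefl : Irreflexive _≡_ _~_

infix 4 _⊢_~_
_⊢_~_ : {V : Set} → Graph V → V → V → Set
G ⊢ u ~ v = Graph._~_ G u v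

infix 4 _≅_
record _≅_ {V W : Set} (G : Graph V) (H : Graph W) : Set where
  field
    bijection : V ↔ W

  open Inverse bijection public using (to; from)

  field
    adjacency : ∀ u v → G ⊢ u ~ v ⇔ H ⊢ to u ~ to v

  adjacent : ∀ {u v} → G ⊢ u ~ v → H ⊢ to u ~ to v
  adjacent {u} {v} = Equivalence.to (adjacency u v)

infix 8 _[_]
_[_] : ∀ {n} → Graph (Fin n) → (S : Subset n) → Graph (∃ (_∈ S))
G [ S ] = record
  { _~_      = λ u v → proj₁ u ~ proj₁ v
  ; _~?_     = λ u v → proj₁ u ~? proj₁ v
  ; ~-sym    = ~-sym
  ; ~-irrefl = λ u≡v → ~-irrefl (cong proj₁ u≡v)
  }
  where open Graph G

GraphFamily : Set₂
GraphFamily = ∀ {k} → Graph (Fin k) → Set₁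

Free : ∀ {n} → GraphFamily → Graph (Fin n) → Set₁
Free {n} 𝓕 G = ∀ {k} {F : Graph (Fin k)} → 𝓕 F → (S : Subset n) → ¬ (G [ S ] ≅ F)

------------------------------------------------------------------------
-- 2-edge-colourings

data Colour : Set where
  red blue : Colour

-- `colour-sym` ranges over all proofs of adjacency, so the colour depends only
-- on the unordered pair of endpoints.
record EdgeColouring {V : Set} (G : Graph V) : Set where
  field
    colour     : ∀ u v → G ⊢ u ~ v → Colour
    colour-sym : ∀ {u v} (e : G ⊢ u ~ v) (e′ : G ⊢ v ~ u) → colour u v e ≡ colour v u e′

open EdgeColouring using (colour)

infix 4 _≅ᶜ_
record _≅ᶜ_ {V W : Set} {G : Graph V} {H : Graph W}
            (c : EdgeColouring G) (d : EdgeColouring H) : Set where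
  field
    isomorphism : G ≅ H

  open _≅_ isomorphism public

  field
    same-colour : ∀ {u v} (e : G ⊢ u ~ v) →
                  colour d (to u) (to v) (adjacent e) ≡ colour c u v e

infix 8 _[_]ᶜ
_[_]ᶜ : ∀ {n} {G : Graph (Fin n)} → EdgeColouring G → (S : Subset n) → EdgeColouring (G [ S ])
c [ S ]ᶜ = record
  { colour     = λ u v → EdgeColouring.colour c (proj₁ u) (proj₁ v)
  ; colour-sym = EdgeColouring.colour-sym c
  }

ColouredFamily : Set₂
ColouredFamily = ∀ {k} {F : Graph (Fin k)} → EdgeColouring F → Set₁

Freeᶜ : ∀ {n} {G : Graph (Fin n)} → ColouredFamily → EdgeColouring G → Set₁
Freeᶜ {n} 𝓕 c =
  ∀ {k} {F : Graph (Fin k)} {d : EdgeColouring F} → 𝓕 d → (S : Subset n) → ¬ (c [ S ]ᶜ ≅ᶜ d)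

------------------------------------------------------------------------
-- Particular graphs

-- Loops of R are discarded.
fromRel : ∀ {n} (R : Rel (Fin n) 0ℓ) → Decidable R → Graph (Fin n)
fromRel {n} R R? = record
  { _~_      = λ u v → u ≢ v × SymClosure R u v
  ; _~?_     = λ u v → ¬? (u ≟ v) ×-dec closure? u v
  ; ~-sym    = λ (u≢v , r) → (λ v≡u → u≢v (sym v≡u)) , symmetric R r
  ; ~-irrefl = λ u≡v (u≢v , _) → u≢v u≡v
  }
  where
  closure? : Decidable (SymClosure R)
  closure? u v = map′ (λ { (inj₁ r) → fwd r ; (inj₂ r) → bwd r })
                      (λ { (fwd r) → inj₁ r ; (bwd r) → inj₂ r })
                      (R? u v ⊎-dec R? v u)

fromEdges : ∀ {n} → List (Fin n × Fin n) → Graph (Fin n)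
fromEdges es = fromRel (λ u v → (u , v) List.∈ es) (λ u v → (u , v) ∈? es)
  where open DecMembership (≡-dec _≟_ _≟_) using (_∈?_)

P₃ : Graph (Fin 3)
P₃ = fromEdges ((0F , 1F) ∷ (1F , 2F) ∷ [])

K₃ : Graph (Fin 3)
K₃ = fromEdges ((0F , 1F) ∷ (1F , 2F) ∷ (0F , 2F) ∷ [])

claw : Graph (Fin 4)
claw = fromEdges ((0F , 1F) ∷ (0F , 2F) ∷ (0F , 3F) ∷ [])

-- K₄ without the edge {0 , 1}.
diamond : Graph (Fin 4)
diamond = fromEdges ((0F , 2F) ∷ (0F , 3F) ∷ (1F , 2F) ∷ (1F , 3F) ∷ (2F , 3F) ∷ [])

-- The cycle 0 , 1 , … , k - 1 , 0; it is a genuine cycle only for k ≥ 3.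
cycle : (k : ℕ) → Graph (Fin k)
cycle k = fromRel
  (λ u v → suc (toℕ u) ≡ toℕ v ⊎ (suc (toℕ u) ≡ k × toℕ v ≡ 0))
  (λ u v → suc (toℕ u) ℕ.≟ toℕ v ⊎-dec (suc (toℕ u) ℕ.≟ k ×-dec toℕ v ℕ.≟ 0))

data ClawDiamondOddHole : GraphFamily where
  is-claw     : ClawDiamondOddHole claw
  is-diamond  : ClawDiamondOddHole diamond
  is-odd-hole : ∀ {k} → 5 ≤ k → k % 2 ≡ 1 → ClawDiamondOddHole (cycle k)

monochromatic : {V : Set} (G : Graph V) → Colour → EdgeColouring G
monochromatic G x = record { colour = λ _ _ _ → x ; colour-sym = λ _ _ → refl }

-- The edges {0 , 2} and {1 , 2} get colour x, the edge {0 , 1} gets colour y.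
two-one : Colour → Colour → EdgeColouring K₃
two-one x y = record
  { colour     = λ u v _ → if is2 u ∨ is2 v then x else y
  ; colour-sym = λ {u} {v} _ _ → cong (if_then x else y) (∨-comm (is2 u) (is2 v))
  }
  where
  is2 : Fin 3 → Bool
  is2 u = does (u ≟ 2F)

ʳP₃ ᵇP₃ : EdgeColouring P₃
ʳP₃ = monochromatic P₃ red
ᵇP₃ = monochromatic P₃ blue

ʳʳᵇK₃ ʳᵇᵇK₃ : EdgeColouring K₃
ʳʳᵇK₃ = two-one red blue
ʳᵇᵇK₃ = two-one blue red

data Patterns : ColouredFamily where
  is-ʳP₃   : Patterns ʳP₃
  is-ᵇP₃   : Patterns ᵇP₃
  is-ʳʳᵇK₃ : Patterns ʳʳᵇK₃
  is-ʳᵇᵇK₃ : Patterns ʳᵇᵇK₃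

------------------------------------------------------------------------
-- Line graphs of bipartite graphs

Bipartite : {V : Set} → Graph V → Set
Bipartite {V} H = Σ (V → Bool) λ side → ∀ {u v} → H ⊢ u ~ v → side u ≢ side v

-- An unordered edge is listed once, by its endpoints in increasing order; the
-- proofs are irrelevant so that an edge is determined by its endpoints.
record Edge {m : ℕ} (H : Graph (Fin m)) : Set where
  constructor edge
  field
    lo hi  : Fin m
    .lo<hi : lo < hi
    .lo~hi : H ⊢ lo ~ hi

infix 4 _isEndOf_
_isEndOf_ : ∀ {m} {H : Graph (Fin m)} → Fin m → Edge H → Set
w isEndOf e = w ≡ Edge.lo e ⊎ w ≡ Edge.hi e

edge-≟ : ∀ {m} (H : Graph (Fin m)) → DecidableEquality (Edge H)
edge-≟ H (edge a b _ _) (edge c d _ _) =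
  map′ (λ { (refl , refl) → refl }) (λ { refl → refl , refl }) (a ≟ c ×-dec b ≟ d)

lineGraph : ∀ {m} (H : Graph (Fin m)) → Graph (Edge H)
lineGraph {m} H = record
  { _~_      = λ e f → e ≢ f × ∃ λ w → w isEndOf e × w isEndOf f
  ; _~?_     = λ e f → ¬? (edge-≟ H e f) ×-dec any? (λ w → end? w e ×-dec end? w f)
  ; ~-sym    = λ (e≢f , w , p) → (λ f≡e → e≢f (sym f≡e)) , w , swap p
  ; ~-irrefl = λ e≡f (e≢f , _) → e≢f e≡f
  }
  where
  end? : (w : Fin m) (e : Edge H) → Dec (w isEndOf e)
  end? w e = w ≟ Edge.lo e ⊎-dec w ≟ Edge.hi e

IsLineGraphOfBipartite : {V : Set} → Graph V → Set₁
IsLineGraphOfBipartite G = ∃ λ m → Σ (Graph (Fin m)) λ H → Bipartite H × G ≅ lineGraph H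

{-# OPTIONS --safe #-}
module Submission where

-- A colouring avoids the four patterns iff, for every path u v w, the edges uv and vw have the same
-- colour exactly when u ~ w.  Such a colouring restricts to induced subgraphs, and claws, diamonds
-- and odd holes have none; its monochromatic cliques are the vertices of the bipartite root graph.
--
-- Conversely, let G avoid the three obstructions and colour G - 0 by induction.  The neighbours of 0
-- form two cliques A and B without edges between them, and the edges already coloured at A (at B)
-- force one common colour on the edges from 0 to A (to B).  These two colours must differ.  If no
-- path of G - 0 joins A to B, the colours on one side can be swapped.  Otherwise a shortest such
-- path closes up through 0 to an induced cycle of length at least 4, which is therefore even; since
-- colours alternate along the path, the two forced colours do differ.

open import Defs
open import Data.Bool.Base using (Bool; true; false; not; _xor_; if_then_else_)
open import Data.Bool.Properties using (¬-not)
open import Data.Fin.Base using (Fin; zero; suc; toℕ; _<_; _↑ˡ_; _↑ʳ_; splitAt)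
open import Data.Fin.Patterns using (0F; 1F; 2F; 3F)
open import Data.Fin.Properties
  using (_≟_; any?; suc-injective; toℕ-injective; toℕ<n; toℕ-fromℕ<; toℕ-↑ˡ; toℕ-↑ʳ;
         ↑ˡ-injective; ↑ʳ-injective; splitAt-↑ˡ; splitAt-↑ʳ; <-cmp; <-asym; _<?_)
open import Data.Fin.Subset using (Subset; _∈_; _∉_; _⊆_; ∣_∣)
open import Data.Fin.Subset.Properties using (_∈?_; ∣p∣≤n; p⊂q⇒∣p∣<∣q∣)
open import Data.Nat.Base as ℕ using (ℕ; zero; suc; _+_; _*_; _∸_; _≤_; z≤n; s≤s; NonZero; _%_; _/_)
open import Data.Nat.DivMod
  using (_mod_; m%n<n; m≡m%n+[m/n]*n; [m+n]%n≡m%n; [m+kn]%n≡m%n; n%n≡0; m<n⇒m%n≡m)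
import Data.Nat.Properties as ℕ
open import Data.Product.Base using (Σ; ∃; _×_; _,_; proj₁; proj₂)
open import Data.Sum.Base using (_⊎_; inj₁; inj₂; [_,_]′)
open import Data.Vec.Base using ([]; _∷_; lookup; tabulate)
open import Data.Vec.Properties using (lookup⇒[]=; []=⇒lookup; lookup∘tabulate)
open import Data.Vec.Properties.WithK using ([]=-irrelevant)
open import Function.Base using (_∘_; id; case_of_)
open import Function.Bundles using (_⇔_; mk⇔; mk↔ₛ′; module Equivalence; module Inverse)
open import Relation.Binary.Construct.Closure.Symmetric using (fwd; bwd)
open import Relation.Binary.Definitions using (tri<; tri≈; tri>)
open import Relation.Binary.Structures using (IsDecEquivalence)
open import Relation.Binary.PropositionalEquality
  using (_≡_; _≢_; refl; sym; trans; cong; cong₂; subst; subst₂; ≢-sym; module ≡-Reasoning)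
open import Relation.Nullary.Decidable
  using (Dec; yes; no; does; True; False; toWitness; toWitnessFalse; dec-true; dec-false; does-⇔;
         decidable-stable; recompute; ¬?; _×-dec_; _⊎-dec_)
open import Relation.Nullary.Negation using (¬_; contradiction)
open import Relation.Unary using (Decidable; Pred)
open import Level using (0ℓ)
import Data.Bool.Properties as Bool

open EdgeColouring using (colour)
open Equivalence using (to; from)

private
  variable
    k n  : ℕ
    V W X : Set

-- Boolean adjacency and exclusive or

adj : Graph V → V → V → Bool
adj G u v = does (Graph._~?_ G u v)

adj-true : (G : Graph V) {u v : V} → G ⊢ u ~ v → adj G u v ≡ true
adj-true G = dec-true (Graph._~?_ G _ _)

adj-false : (G : Graph V) {u v : V} → ¬ G ⊢ u ~ v → adj G u v ≡ false
adj-false G = dec-false (Graph._~?_ G _ _)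

xor-false⇒≡ : ∀ {x y} → x xor y ≡ false → x ≡ y
xor-false⇒≡ {false} p = sym p
xor-false⇒≡ {true} {true} p = refl

xor-true⇒≢ : ∀ {x y} → x xor y ≡ true → x ≢ y
xor-true⇒≢ {false} {false} ()
xor-true⇒≢ {true}  {true}  ()
xor-true⇒≢ {false} {true} _ ()
xor-true⇒≢ {true} {false} _ ()

xor-true⇒≡not : ∀ {x y} → x xor y ≡ true → y ≡ not x
xor-true⇒≡not {false}        p = p
xor-true⇒≡not {true} {false} p = refl

xor-exchange : ∀ x y {z w} → x xor y ≡ z xor w → x xor z ≡ y xor w
xor-exchange false false p = xor-false⇒≡ (sym p)
xor-exchange false true  p = ¬-not (xor-true⇒≢ (sym p))
xor-exchange true  false p = sym (xor-true⇒≡not (sym p))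
xor-exchange true  true  p = cong not (xor-false⇒≡ (sym p))

-- Induced subgraphs as embeddings

select : {P : Pred (Fin n) 0ℓ} → Decidable P → Subset n
select P? = tabulate (does ∘ P?)

∈-select⁺ : {P : Pred (Fin n) 0ℓ} (P? : Decidable P) {x : Fin n} → P x → x ∈ select P?
∈-select⁺ P? {x} p = lookup⇒[]= x _ (trans (lookup∘tabulate _ x) (dec-true (P? x) p))

∈-select⁻ : {P : Pred (Fin n) 0ℓ} (P? : Decidable P) {x : Fin n} → x ∈ select P? → P x
∈-select⁻ P? {x} x∈ with P? x | trans (sym (lookup∘tabulate (does ∘ P?) x)) ([]=⇒lookup x∈)
... | yes p | _ = p

∈-ext : {S : Subset n} {x y : ∃ (_∈ S)} → proj₁ x ≡ proj₁ y → x ≡ y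
∈-ext {x = x , p} {y = _ , q} refl = cong (x ,_) ([]=-irrelevant p q)

infix 4 _↪_
-- Adjacency is also reflected, so the image induces a copy of `F`. Unlike the isomorphisms onto
-- `G [ S ]`, these maps compose directly.
record _↪_ (F : Graph V) (G : Graph W) : Set where
  field
    embed     : V → W
    injective : ∀ {u v} → embed u ≡ embed v → u ≡ v
    adjacency : ∀ u v → F ⊢ u ~ v ⇔ G ⊢ embed u ~ embed v

open _↪_

↪-trans : {F : Graph V} {G : Graph W} {H : Graph X} → F ↪ G → G ↪ H → F ↪ H
↪-trans f g = record
  { embed     = embed g ∘ embed f
  ; injective = injective f ∘ injective g
  ; adjacency = λ u v → mk⇔ (to (adjacency g _ _) ∘ to (adjacency f u v))
                            (from (adjacency f u v) ∘ from (adjacency g _ _))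
  }

≅⇒↪ : {G : Graph V} {H : Graph W} → G ≅ H → G ↪ H
≅⇒↪ φ = record
  { embed     = _≅_.to φ
  ; injective = λ {u} {v} eq → trans (sym (from∘to u)) (trans (cong (_≅_.from φ) eq) (from∘to v))
  ; adjacency = _≅_.adjacency φ
  }
  where
  from∘to = Inverse.strictlyInverseʳ (_≅_.bijection φ)

module _ {F : Graph V} {G : Graph (Fin n)} {S : Subset n} (φ : G [ S ] ≅ F) where
  private
    module φ = _≅_ φ

    to∘from : ∀ i → φ.to (φ.from i) ≡ i
    to∘from = Inverse.strictlyInverseˡ φ.bijection

  induced⇒↪ : F ↪ G
  induced⇒↪ = record
    { embed     = proj₁ ∘ φ.from
    ; injective = λ {i} {j} eq →
        trans (sym (to∘from i)) (trans (cong φ.to (∈-ext eq)) (to∘from j))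
    ; adjacency = λ i j → mk⇔
        (λ e → from (φ.adjacency (φ.from i) (φ.from j))
                    (subst₂ (F ⊢_~_) (sym (to∘from i)) (sym (to∘from j)) e))
        (λ e → subst₂ (F ⊢_~_) (to∘from i) (to∘from j) (φ.adjacent e))
    }

module _ {F : Graph (Fin k)} {G : Graph (Fin n)} (f : F ↪ G) where
  private
    image? : Decidable (λ x → ∃ λ i → embed f i ≡ x)
    image? x = any? (λ i → embed f i ≟ x)

  image : Subset n
  image = select image?

  private
    index : ∃ (_∈ image) → Fin k
    index (_ , x∈) = proj₁ (∈-select⁻ image? x∈)

    vertex : Fin k → ∃ (_∈ image)
    vertex i = embed f i , ∈-select⁺ image? (i , refl)

  embed∘index : ∀ x → embed f (index x) ≡ proj₁ x
  embed∘index (_ , x∈) = proj₂ (∈-select⁻ image? x∈)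

  image≅ : G [ image ] ≅ F
  image≅ = record
    { bijection = mk↔ₛ′ index vertex
                        (λ i → injective f (embed∘index (vertex i)))
                        (λ x → ∈-ext (embed∘index x))
    ; adjacency = λ u v → mk⇔
        (λ e → from (adjacency f _ _)
                 (subst₂ (G ⊢_~_) (sym (embed∘index u)) (sym (embed∘index v)) e))
        (λ e → subst₂ (G ⊢_~_) (embed∘index u) (embed∘index v) (to (adjacency f _ _) e))
    }

Avoids : GraphFamily → Graph V → Set₁
Avoids 𝓕 G = ∀ {k} {F : Graph (Fin k)} → 𝓕 F → ¬ (F ↪ G)

Free⇒Avoids : {𝓕 : GraphFamily} {G : Graph (Fin n)} → Free 𝓕 G → Avoids 𝓕 G
Free⇒Avoids free F∈ f = free F∈ (image f) (image≅ f)

Avoids⇒Free : {𝓕 : GraphFamily} {G : Graph (Fin n)} → Avoids 𝓕 G → Free 𝓕 G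
Avoids⇒Free avoids F∈ S φ = avoids F∈ (induced⇒↪ φ)

-- Distinctness is stored only in the case `apart`; adjacent vertices are distinct by irreflexivity.
data Fits (F : Graph V) (G : Graph W) (f : V → W) (i j : V) : Set where
  joined : F ⊢ i ~ j → G ⊢ f i ~ f j → Fits F G f i j
  apart  : ¬ F ⊢ i ~ j → f i ≢ f j → ¬ G ⊢ f i ~ f j → Fits F G f i j

-- On a concrete `F` the implicit `True` argument is solved by evaluating the adjacency test.
joined! : {F : Graph V} {G : Graph W} {f : V → W} {i j : V} {_ : True (Graph._~?_ F i j)} →
          G ⊢ f i ~ f j → Fits F G f i j
joined! {_} {_} {_} {_} {_} {_} {_} {p} = joined (toWitness p)

apart! : {F : Graph V} {G : Graph W} {f : V → W} {i j : V} {_ : False (Graph._~?_ F i j)} →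
         f i ≢ f j → ¬ G ⊢ f i ~ f j → Fits F G f i j
apart! {_} {_} {_} {_} {_} {_} {_} {p} = apart (toWitnessFalse p)

fits⇒↪ : {F : Graph (Fin k)} {G : Graph W} (f : Fin k → W) →
         (∀ i j → i < j → Fits F G f i j) → F ↪ G
fits⇒↪ {F = F} {G = G} f fits = record
  { embed = f
  ; injective = λ {i} {j} → inj i j
  ; adjacency = λ i j → mk⇔ (⇒ i j) (⇐ i j)
  }
  where
  module F = Graph F
  module G = Graph G
  distinct : ∀ {i j} → Fits F G f i j → f i ≢ f j
  distinct (joined _ e) eq = G.~-irrefl eq e
  distinct (apart _ i≢j _) = i≢j
  fwd′ : ∀ {i j} → Fits F G f i j → F ⊢ i ~ j → G ⊢ f i ~ f j
  fwd′ (joined _ e)   _ = e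
  fwd′ (apart ¬e _ _) e = contradiction e ¬e
  bwd′ : ∀ {i j} → Fits F G f i j → G ⊢ f i ~ f j → F ⊢ i ~ j
  bwd′ (joined e _)   _ = e
  bwd′ (apart _ _ ¬e) e = contradiction e ¬e
  inj : ∀ i j → f i ≡ f j → i ≡ j
  inj i j eq with <-cmp i j
  ... | tri< i<j _ _ = contradiction eq (distinct (fits i j i<j))
  ... | tri≈ _ i≡j _ = i≡j
  ... | tri> _ _ j<i = contradiction (sym eq) (distinct (fits j i j<i))
  ⇒ : ∀ i j → F ⊢ i ~ j → G ⊢ f i ~ f j
  ⇒ i j e with <-cmp i j
  ... | tri< i<j _ _ = fwd′ (fits i j i<j) e
  ... | tri≈ _ i≡j _ = contradiction e (F.~-irrefl i≡j)
  ... | tri> _ _ j<i = G.~-sym (fwd′ (fits j i j<i) (F.~-sym e))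
  ⇐ : ∀ i j → G ⊢ f i ~ f j → F ⊢ i ~ j
  ⇐ i j e with <-cmp i j
  ... | tri< i<j _ _ = bwd′ (fits i j i<j) e
  ... | tri≈ _ i≡j _ = contradiction e (G.~-irrefl (cong f i≡j))
  ... | tri> _ _ j<i = F.~-sym (bwd′ (fits j i j<i) (G.~-sym e))

pairs₃ : {R : Fin 3 → Fin 3 → Set} → R 0F 1F → R 0F 2F → R 1F 2F → ∀ i j → i < j → R i j
pairs₃ r₀₁ r₀₂ r₁₂ 0F 1F _ = r₀₁
pairs₃ r₀₁ r₀₂ r₁₂ 0F 2F _ = r₀₂
pairs₃ r₀₁ r₀₂ r₁₂ 1F 2F _ = r₁₂
pairs₃ _ _ _ (suc _)       1F (s≤s ())
pairs₃ _ _ _ (suc (suc _)) 2F (s≤s (s≤s ()))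

pairs₄ : {R : Fin 4 → Fin 4 → Set} → R 0F 1F → R 0F 2F → R 0F 3F → R 1F 2F → R 1F 3F → R 2F 3F →
         ∀ i j → i < j → R i j
pairs₄ r₀₁ r₀₂ r₀₃ r₁₂ r₁₃ r₂₃ 0F 1F _ = r₀₁
pairs₄ r₀₁ r₀₂ r₀₃ r₁₂ r₁₃ r₂₃ 0F 2F _ = r₀₂
pairs₄ r₀₁ r₀₂ r₀₃ r₁₂ r₁₃ r₂₃ 0F 3F _ = r₀₃
pairs₄ r₀₁ r₀₂ r₀₃ r₁₂ r₁₃ r₂₃ 1F 2F _ = r₁₂
pairs₄ r₀₁ r₀₂ r₀₃ r₁₂ r₁₃ r₂₃ 1F 3F _ = r₁₃
pairs₄ r₀₁ r₀₂ r₀₃ r₁₂ r₁₃ r₂₃ 2F 3F _ = r₂₃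
pairs₄ _ _ _ _ _ _ (suc _)             1F (s≤s ())
pairs₄ _ _ _ _ _ _ (suc (suc _))       2F (s≤s (s≤s ()))
pairs₄ _ _ _ _ _ _ (suc (suc (suc _))) 3F (s≤s (s≤s (s≤s ())))

-- Krausz colourings

-- The two hues are the two sides of H when G is the line graph of a bipartite graph H: the edges of
-- one hue form disjoint cliques, and each vertex lies in at most one clique of either hue.
record KrauszColouring (G : Graph V) : Set where
  field
    hue     : V → V → Bool
    hue-sym : ∀ {u v} → G ⊢ u ~ v → hue u v ≡ hue v u
    turn    : ∀ {u v w} → G ⊢ u ~ v → G ⊢ v ~ w → u ≢ w →
              hue u v xor hue v w ≡ not (adj G u w)

-- The conditions only compare and connect up to three vertices, which an induced embedding
-- preserves and reflects.
pullback : {F : Graph V} {G : Graph W} → F ↪ G → KrauszColouring G → KrauszColouring F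
pullback {F = F} {G = G} f K = record
  { hue     = λ u v → hue (embed f u) (embed f v)
  ; hue-sym = λ e → hue-sym (to (adjacency f _ _) e)
  ; turn    = λ {u} {v} {w} e e′ u≢w →
      trans (turn (to (adjacency f _ _) e) (to (adjacency f _ _) e′) (u≢w ∘ injective f))
            (cong not (sym (does-⇔ (adjacency f u w) (Graph._~?_ F u w) (Graph._~?_ G _ _))))
  }
  where open KrauszColouring K

-- Colourings free of the four patterns

isRed : Colour → Bool
isRed red  = true
isRed blue = false

toColour : Bool → Colour
toColour true  = red
toColour false = blue

isRed∘toColour : ∀ b → isRed (toColour b) ≡ b
isRed∘toColour true  = refl
isRed∘toColour false = refl

isRed-injective : ∀ {x y} → isRed x ≡ isRed y → x ≡ y
isRed-injective {red}  {red}  _ = refl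
isRed-injective {blue} {blue} _ = refl

monochromatic-pattern : ∀ x → Patterns (monochromatic P₃ x)
monochromatic-pattern red  = is-ʳP₃
monochromatic-pattern blue = is-ᵇP₃

two-one-pattern : ∀ {x y} → x ≢ y → Patterns (two-one x y)
two-one-pattern {red}  {red}  x≢y = contradiction refl x≢y
two-one-pattern {red}  {blue} _   = is-ʳʳᵇK₃
two-one-pattern {blue} {red}  _   = is-ʳᵇᵇK₃
two-one-pattern {blue} {blue} x≢y = contradiction refl x≢y

module _ {G : Graph V} (c : EdgeColouring G) where
  open EdgeColouring c using (colour-sym)

  -- Colours depend formally on adjacency proofs. Passing to the reversed edge and back by
  -- `colour-sym` removes that dependence.
  colour-irrelevant : ∀ {u v u′ v′} → u ≡ u′ → v ≡ v′ → (e : G ⊢ u ~ v) (e′ : G ⊢ u′ ~ v′) →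
                      colour c u v e ≡ colour c u′ v′ e′
  colour-irrelevant refl refl e e′ =
    trans (colour-sym e (Graph.~-sym G e)) (colour-sym (Graph.~-sym G e) e′)

module _ {G : Graph (Fin n)} {c : EdgeColouring G} {F : Graph (Fin k)} {d : EdgeColouring F} where

  SameColour : (Fin k → Fin n) → Fin k → Fin k → Set
  SameColour f i j = (e : F ⊢ i ~ j) (e′ : G ⊢ f i ~ f j) → colour d i j e ≡ colour c (f i) (f j) e′

  pattern-free : {𝓕 : ColouredFamily} → Freeᶜ 𝓕 c → 𝓕 d → (f : F ↪ G) →
                 ¬ (∀ i j → i < j → SameColour (embed f) i j)
  pattern-free free d∈ f same = free d∈ (image f) record
    { isomorphism = image≅ f
    ; same-colour = λ {u} {v} e →
        let e′ = _≅_.adjacent (image≅ f) {u} {v} e in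
        trans (same′ _ _ e′ (to (adjacency f _ _) e′))
              (colour-irrelevant c (embed∘index f u) (embed∘index f v) _ e)
    }
    where
    same′ : ∀ i j → SameColour (embed f) i j
    same′ i j e e′ with <-cmp i j
    ... | tri< i<j _ _ = same i j i<j e e′
    ... | tri≈ _ i≡j _ = contradiction e (Graph.~-irrefl F i≡j)
    ... | tri> _ _ j<i =
      trans (EdgeColouring.colour-sym d e (Graph.~-sym F e))
            (trans (same j i j<i _ (Graph.~-sym G e′)) (EdgeColouring.colour-sym c _ e′))

  induced-colour : {S : Subset n} (φ : c [ S ]ᶜ ≅ᶜ d) →
                   ∀ i j → SameColour (embed (induced⇒↪ {G = G} (_≅ᶜ_.isomorphism φ))) i j
  induced-colour φ i j e e′ =
    trans (colour-irrelevant d (sym (to∘from i)) (sym (to∘from j)) e _) (φ.same-colour e′)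
    where
    module φ = _≅ᶜ_ φ
    to∘from = Inverse.strictlyInverseˡ φ.bijection

module _ {G : Graph (Fin n)} (c : EdgeColouring G) (free : Freeᶜ Patterns c) where
  open Graph G
  open EdgeColouring c using (colour-sym)

  -- Otherwise `u`, `v`, `w` would induce a monochromatic path.
  path-colours : ∀ {u v w} (e : u ~ v) (e′ : v ~ w) → u ≢ w → ¬ u ~ w →
                 colour c u v e ≢ colour c v w e′
  path-colours {u} {v} {w} e e′ u≢w ¬u~w eq =
    pattern-free {d = monochromatic P₃ (colour c u v e)}
      free (monochromatic-pattern (colour c u v e)) f
      (pairs₃ (λ _ _ → colour-irrelevant c refl refl e _)
              (λ _ e″ → contradiction e″ ¬u~w)
              (λ _ _ → trans eq (colour-irrelevant c refl refl e′ _)))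
    where
    f : P₃ ↪ G
    f = fits⇒↪ (lookup (u ∷ v ∷ w ∷ [])) (pairs₃ (joined! e) (apart! u≢w ¬u~w) (joined! e′))

  -- Otherwise the triangle would have two edges of one colour and one of the other, with `w` in the
  -- role of vertex 2 of `two-one`.
  triangle-colours : ∀ {u v w} (e : u ~ w) (e′ : v ~ w) (e″ : u ~ v) →
                     colour c u w e ≡ colour c v w e′ → colour c u w e ≡ colour c u v e″
  triangle-colours {u} {v} {w} e e′ e″ eq =
    isRed-injective (decidable-stable (_ Bool.≟ _) λ neq →
      pattern-free {d = two-one (colour c u w e) (colour c u v e″)}
        free (two-one-pattern (neq ∘ cong isRed)) f
        (pairs₃ (λ _ _ → colour-irrelevant c refl refl e″ _)
                (λ _ _ → colour-irrelevant c refl refl e _)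
                (λ _ _ → trans eq (colour-irrelevant c refl refl e′ _))))
    where
    f : K₃ ↪ G
    f = fits⇒↪ (lookup (u ∷ v ∷ w ∷ [])) (pairs₃ (joined! e″) (joined! e) (joined! e′))

  pattern-free⇒Krausz : KrauszColouring G
  pattern-free⇒Krausz = record
    { hue     = λ u v → hueOf (u ~? v)
    ; hue-sym = λ {u} {v} e → trans (hueOf≡ (u ~? v) e)
                  (trans (cong isRed (colour-sym e (~-sym e))) (sym (hueOf≡ (v ~? u) (~-sym e))))
    ; turn    = λ {u} {v} {w} e e′ u≢w →
        trans (cong₂ _xor_ (hueOf≡ (u ~? v) e) (hueOf≡ (v ~? w) e′)) (turn e e′ u≢w)
    }
    where
    hueOf : ∀ {u v} → Dec (u ~ v) → Bool
    hueOf {u} {v} (yes e) = isRed (colour c u v e)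
    -- Arbitrary value: `hue-sym` and `turn` only read hues of edges.
    hueOf         (no _)  = false

    hueOf≡ : ∀ {u v} (d : Dec (u ~ v)) (e : u ~ v) → hueOf d ≡ isRed (colour c u v e)
    hueOf≡ (yes e′) e = cong isRed (colour-irrelevant c refl refl e′ e)
    hueOf≡ (no ¬e)  e = contradiction e ¬e

    different : ∀ {x y} → x ≢ y → isRed x xor isRed y ≡ true
    different {red}  {red}  x≢y = contradiction refl x≢y
    different {red}  {blue} _   = refl
    different {blue} {red}  _   = refl
    different {blue} {blue} x≢y = contradiction refl x≢y

    -- Two of any three colours agree.
    agree : ∀ {x y z} → (z ≡ x → x ≡ y) → (z ≡ y → y ≡ x) → isRed x xor isRed y ≡ false
    agree {red}  {red}         _ _ = refl
    agree {blue} {blue}        _ _ = refl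
    agree {red}  {blue} {red}  p _ = case p refl of λ ()
    agree {red}  {blue} {blue} _ q = case q refl of λ ()
    agree {blue} {red}  {red}  _ q = case q refl of λ ()
    agree {blue} {red}  {blue} p _ = case p refl of λ ()

    turn : ∀ {u v w} (e : u ~ v) (e′ : v ~ w) → u ≢ w →
           isRed (colour c u v e) xor isRed (colour c v w e′) ≡ not (adj G u w)
    turn {u} {v} {w} e e′ u≢w with u ~? w
    ... | no ¬e″ = different (path-colours e e′ u≢w ¬e″)
    -- If uv and vw disagreed, uw would match one of them, and `triangle-colours` at their common
    -- endpoint would make all three colours equal.
    ... | yes e″ = agree {z = colour c u w e″}
      (λ z≡x → trans (colour-sym e (~-sym e))
         (triangle-colours (~-sym e) (~-sym e″) e′
           (trans (colour-sym (~-sym e) e) (trans (sym z≡x) (colour-sym e″ (~-sym e″))))))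
      (λ z≡y → trans (sym z≡y) (triangle-colours e″ e′ e z≡y))

-- The ends of `P₃` are not adjacent, so `turn` at the middle vertex forces different hues.
no-path : ∀ x (L : KrauszColouring P₃) →
          ¬ (∀ i j (e : P₃ ⊢ i ~ j) → x ≡ KrauszColouring.hue L i j)
no-path x L same = xor-true⇒≢ {hue 0F 1F} {hue 1F 2F} (turn 01~ 12~ (λ ()))
                              (trans (sym (same 0F 1F 01~)) (same 1F 2F 12~))
  where
  open KrauszColouring L
  01~ : P₃ ⊢ 0F ~ 1F
  01~ = toWitness {a? = Graph._~?_ P₃ 0F 1F} _
  12~ : P₃ ⊢ 1F ~ 2F
  12~ = toWitness {a? = Graph._~?_ P₃ 1F 2F} _

-- Every `turn` in a triangle gives equal hues; here it is applied to the edges 20 and 01, which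
-- carry `x` and `y`.
no-triangle : ∀ x y (L : KrauszColouring K₃) →
              (∀ i j (e : K₃ ⊢ i ~ j) → isRed (colour (two-one x y) i j e) ≡ KrauszColouring.hue L i j) →
              x ≡ y
no-triangle x y L same = isRed-injective
  (trans (same 2F 0F 20~) (trans (xor-false⇒≡ {hue 2F 0F} (turn 20~ 01~ (λ ()))) (sym (same 0F 1F 01~))))
  where
  open KrauszColouring L
  20~ : K₃ ⊢ 2F ~ 0F
  20~ = toWitness {a? = Graph._~?_ K₃ 2F 0F} _
  01~ : K₃ ⊢ 0F ~ 1F
  01~ = toWitness {a? = Graph._~?_ K₃ 0F 1F} _

no-pattern : ∀ {k} {F : Graph (Fin k)} {d : EdgeColouring F} → Patterns d →
             (L : KrauszColouring F) →
             ¬ (∀ i j e → isRed (colour d i j e) ≡ KrauszColouring.hue L i j)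
no-pattern is-ʳP₃   L same = no-path true  L same
no-pattern is-ᵇP₃   L same = no-path false L same
no-pattern is-ʳʳᵇK₃ L same = case no-triangle red blue L same of λ ()
no-pattern is-ʳᵇᵇK₃ L same = case no-triangle blue red L same of λ ()


module _ {G : Graph (Fin n)} (K : KrauszColouring G) where
  open KrauszColouring K

  edgeColouring : EdgeColouring G
  edgeColouring = record
    { colour     = λ u v _ → toColour (hue u v)
    ; colour-sym = λ e _ → cong toColour (hue-sym e)
    }

  edgeColouring-free : Freeᶜ Patterns edgeColouring
  edgeColouring-free {F = F} {d = d} d∈ S φ = no-pattern d∈ (pullback f K) λ i j e →
    trans (cong isRed (induced-colour {c = edgeColouring} φ i j e (to (adjacency f i j) e)))
          (isRed∘toColour _)
    where
    f : F ↪ G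
    f = induced⇒↪ {G = G} (_≅ᶜ_.isomorphism φ)

-- Line graphs of bipartite graphs

module _ {m : ℕ} {H : Graph (Fin m)} (bip : Bipartite H) where
  private
    side = proj₁ bip
    open Edge

    lo≢hi : (e : Edge H) → side (lo e) ≢ side (hi e)
    lo≢hi (edge a b _ a~b) = proj₂ bip (recompute (Graph._~?_ H a b) a~b)

  -- The two ends lie on different sides, so if `lo e` is not on side `b`, then `hi e` is.
  endAt : Bool → Edge H → Fin m
  endAt b e = if does (side (lo e) Bool.≟ b) then lo e else hi e

  endAt-isEnd : ∀ b e → endAt b e isEndOf e
  endAt-isEnd b e with side (lo e) Bool.≟ b
  ... | yes _ = inj₁ refl
  ... | no _  = inj₂ refl

  endAt-unique : ∀ {w} e → w isEndOf e → w ≡ endAt (side w) e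
  endAt-unique e (inj₁ refl) with side (lo e) Bool.≟ side (lo e)
  ... | yes _ = refl
  ... | no ¬p = contradiction refl ¬p
  endAt-unique e (inj₂ refl) with side (lo e) Bool.≟ side (hi e)
  ... | yes p = contradiction p (lo≢hi e)
  ... | no _  = refl

  Meet : Bool → Edge H → Edge H → Set
  Meet b e f = endAt b e ≡ endAt b f

  -- Each end of `e` is its end on some side, hence an end of `f` too. The order of the listed
  -- endpoints excludes a swapped match.
  meet-both⇒≡ : ∀ {e f} → (∀ b → Meet b e f) → e ≡ f
  meet-both⇒≡ {e} {f} meet = ≡-by-ends (carry (inj₁ refl)) (carry (inj₂ refl))
    where
    carry : ∀ {w} → w isEndOf e → w isEndOf f
    carry {w} w∈e = subst (_isEndOf f) (sym (trans (endAt-unique e w∈e) (meet (side w))))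
                          (endAt-isEnd (side w) f)

    ≡-by-ends : ∀ {e f} → lo e isEndOf f → hi e isEndOf f → e ≡ f
    ≡-by-ends (inj₁ refl) (inj₂ refl) = refl
    ≡-by-ends {e} (inj₁ refl) (inj₁ refl) = contradiction refl (lo≢hi e)
    ≡-by-ends {e} (inj₂ refl) (inj₂ refl) = contradiction refl (lo≢hi e)
    ≡-by-ends {edge _ _ lo<hi _} {edge _ _ lo<hi′ _} (inj₂ refl) (inj₁ refl) =
      contradiction (recompute (_ <? _) lo<hi′) (<-asym (recompute (_ <? _) lo<hi))

  adjacent⇒meet : ∀ {e f} → lineGraph H ⊢ e ~ f → ∃ λ b → Meet b e f
  adjacent⇒meet {e} {f} (_ , w , w∈e , w∈f) =
    side w , trans (sym (endAt-unique e w∈e)) (endAt-unique f w∈f)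

  meet⇒adjacent : ∀ {e f} b → e ≢ f → Meet b e f → lineGraph H ⊢ e ~ f
  meet⇒adjacent {e} {f} b e≢f m =
    e≢f , endAt b e , endAt-isEnd b e , subst (_isEndOf f) (sym m) (endAt-isEnd b f)

  -- The hue is the side on which two edges meet. Consecutive meetings on the same side compose by
  -- transitivity.
  lineGraph-Krausz : KrauszColouring (lineGraph H)
  lineGraph-Krausz = record
    { hue     = λ e f → does (meet? e f)
    ; hue-sym = λ {e} {f} _ → does-⇔ (mk⇔ sym sym) (meet? e f) (meet? f e)
    ; turn    = turn
    }
    where
    L = lineGraph H
    meet? : ∀ e f → Dec (Meet true e f)
    meet? e f = endAt true e ≟ endAt true f

    otherwise : ∀ {e f} → L ⊢ e ~ f → ¬ Meet true e f → Meet false e f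
    otherwise e~f ¬m with adjacent⇒meet e~f
    ... | true  , m = contradiction m ¬m
    ... | false , m = m

    both : ∀ {e f} → Meet true e f → Meet false e f → e ≡ f
    both m m′ = meet-both⇒≡ λ { true → m ; false → m′ }

    -- If `e` and `g` met, it would be on the side `false`, like `f` and `g`; then `e` and `f` would
    -- meet on both sides and coincide.
    far : ∀ {e f g} → L ⊢ e ~ f → L ⊢ f ~ g → Meet true e f → ¬ Meet true f g → ¬ L ⊢ e ~ g
    far e~f f~g m ¬m e~g = Graph.~-irrefl L
      (both m (trans (otherwise e~g (λ m′ → ¬m (trans (sym m) m′))) (sym (otherwise f~g ¬m)))) e~f

    turn : ∀ {e f g} → L ⊢ e ~ f → L ⊢ f ~ g → e ≢ g →
           does (meet? e f) xor does (meet? f g) ≡ not (adj L e g)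
    turn {e} {f} {g} e~f f~g e≢g with meet? e f | meet? f g
    ... | yes m | yes m′ = cong not (sym (adj-true L (meet⇒adjacent true e≢g (trans m m′))))
    ... | no ¬m | no ¬m′ = cong not (sym (adj-true L (meet⇒adjacent false e≢g
                             (trans (otherwise e~f ¬m) (otherwise f~g ¬m′)))))
    ... | yes m | no ¬m  = cong not (sym (adj-false L (far e~f f~g m ¬m)))
    ... | no ¬m | yes m  = cong not (sym (adj-false L (far (Graph.~-sym L f~g) (Graph.~-sym L e~f)
                             (sym m) (¬m ∘ sym) ∘ Graph.~-sym L)))

-- Canonical representatives of equivalence classes

smallest : {P : Pred (Fin n) 0ℓ} → Decidable P → ∃ P → ∃ λ i → P i × ∀ j → j < i → ¬ P j
smallest {suc n} P? (i , p) with P? zero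
... | yes p₀ = zero , p₀ , λ _ ()
smallest {suc n} P? (zero  , p) | no ¬p₀ = contradiction p ¬p₀
smallest {suc n} P? (suc i , p) | no ¬p₀ =
  let j , pⱼ , min = smallest (P? ∘ suc) (i , p) in
  suc j , pⱼ , λ { zero _ → ¬p₀ ; (suc k) (s≤s k<j) → min k k<j }

-- A quotient of `Fin n` is encoded by the least members of the classes, so that classes can serve
-- as vertices.
module Representative {_≈_ : Fin n → Fin n → Set} (equiv : IsDecEquivalence _≈_) where
  private
    module ≈ = IsDecEquivalence equiv

    least : ∀ u → ∃ λ i → u ≈ i × ∀ j → j < i → ¬ u ≈ j
    least u = smallest (u ≈.≟_) (u , ≈.refl)

  rep : Fin n → Fin n
  rep u = proj₁ (least u)

  rep-cong : ∀ {u v} → u ≈ v → rep u ≡ rep v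
  rep-cong {u} {v} u≈v with least u | least v
  ... | i , u≈i , i-min | j , v≈j , j-min with <-cmp i j
  ...   | tri< i<j _ _ = contradiction (≈.trans (≈.sym u≈v) u≈i) (j-min i i<j)
  ...   | tri≈ _ i≡j _ = i≡j
  ...   | tri> _ _ j<i = contradiction (≈.trans u≈v v≈j) (i-min j j<i)

  rep-injective : ∀ {u v} → rep u ≡ rep v → u ≈ v
  rep-injective {u} {v} eq = ≈.trans (proj₁ (proj₂ (least u)))
    (≈.sym (subst (v ≈_) (sym eq) (proj₁ (proj₂ (least v)))))

-- The bipartite root graph of a Krausz colouring

module _ {G : Graph (Fin n)} (K : KrauszColouring G) where
  open Graph G
  open KrauszColouring K

  -- The classes are the maximal cliques of hue `b`. The case `u ≡ v` gives a singleton class to a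
  -- vertex without edges of that hue.
  SameClass : Bool → Fin n → Fin n → Set
  SameClass b u v = u ≡ v ⊎ (u ~ v × hue u v ≡ b)

  -- Equal hues at `v` force `u` and `w` to be adjacent or equal, and a triangle has only one hue.
  sameClass-trans : ∀ {b u v w} → SameClass b u v → SameClass b v w → SameClass b u w
  sameClass-trans (inj₁ refl) q = q
  sameClass-trans p (inj₁ refl) = p
  sameClass-trans {b} {u} {v} {w} (inj₂ (e , p)) (inj₂ (e′ , q)) with u ≟ w | u ~? w
  ... | yes u≡w | _      = inj₁ u≡w
  ... | no u≢w  | yes e″ = inj₂ (e″ , trans (sym vu≡uw) (trans (hue-sym (~-sym e)) p))
    where
    vu≡uw : hue v u ≡ hue u w
    vu≡uw = xor-false⇒≡
      (trans (turn (~-sym e) e″ (λ v≡w → ~-irrefl v≡w e′)) (cong not (adj-true G e′)))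
  ... | no u≢w  | no ¬e  = contradiction (trans p (sym q))
    (xor-true⇒≢ (trans (turn e e′ u≢w) (cong not (adj-false G ¬e))))

  sameClass-isDecEquivalence : ∀ b → IsDecEquivalence (SameClass b)
  sameClass-isDecEquivalence b = record
    { isEquivalence = record
      { refl  = inj₁ refl
      ; sym   = λ { (inj₁ eq)      → inj₁ (sym eq)
                  ; (inj₂ (e , p)) → inj₂ (~-sym e , trans (hue-sym (~-sym e)) p) }
      ; trans = sameClass-trans
      }
    ; _≟_ = λ u v → u ≟ v ⊎-dec (u ~? v ×-dec hue u v Bool.≟ b)
    }

  sameClass-both⇒≡ : ∀ {u v} → SameClass true u v → SameClass false u v → u ≡ v
  sameClass-both⇒≡ (inj₁ eq) _ = eq
  sameClass-both⇒≡ _ (inj₁ eq) = eq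
  sameClass-both⇒≡ (inj₂ (_ , p)) (inj₂ (_ , q)) = case trans (sym p) q of λ ()

  private
    module Class (b : Bool) = Representative (sameClass-isDecEquivalence b)

    -- Classes of hue `true` use the first `n` numbers, those of hue `false` the last `n`. Numbers
    -- representing no class are isolated in `classGraph` and leave its line graph unchanged.
    low high : Fin n → Fin (n + n)
    low  u = Class.rep true u ↑ˡ n
    high u = n ↑ʳ Class.rep false u

    low≢high : ∀ {u v} → low u ≢ high v
    low≢high {u} {v} eq with trans (sym (splitAt-↑ˡ n (Class.rep true u) n))
                                   (trans (cong (splitAt n) eq) (splitAt-↑ʳ n n (Class.rep false v)))
    ... | ()

    low<high : ∀ u v → low u < high v
    low<high u v = subst₂ ℕ._<_ (sym (toℕ-↑ˡ (Class.rep true u) n)) (sym (toℕ-↑ʳ n (Class.rep false v)))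
                     (ℕ.≤-trans (toℕ<n (Class.rep true u)) (ℕ.m≤m+n n _))

    Joins : Fin (n + n) → Fin (n + n) → Fin n → Set
    Joins a b v = low v ≡ a × high v ≡ b

    joins? : ∀ a b → Dec (∃ (Joins a b))
    joins? a b = any? λ v → low v ≟ a ×-dec high v ≟ b

  -- Each vertex of `G` becomes the edge that joins its two classes.
  classGraph : Graph (Fin (n + n))
  classGraph = fromRel (λ a b → ∃ (Joins a b)) joins?

  classGraph-bipartite : Bipartite classGraph
  classGraph-bipartite = side , λ { (_ , fwd p) → opposite p ; (_ , bwd p) → ≢-sym (opposite p) }
    where
    side : Fin (n + n) → Bool
    side a = [ (λ _ → true) , (λ _ → false) ]′ (splitAt n a)

    opposite : ∀ {a b} → ∃ (Joins a b) → side a ≢ side b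
    opposite (v , refl , refl)
      rewrite splitAt-↑ˡ n (Class.rep true v) n | splitAt-↑ʳ n n (Class.rep false v) = λ ()

  private
    toEdge : Fin n → Edge classGraph
    toEdge v = edge (low v) (high v) (low<high v v) (low≢high {v} {v} , fwd (v , refl , refl))

    toEdge-injective : ∀ {u v} → toEdge u ≡ toEdge v → u ≡ v
    toEdge-injective eq = sameClass-both⇒≡
      (Class.rep-injective true (↑ˡ-injective n _ _ (cong Edge.lo eq)))
      (Class.rep-injective false (↑ʳ-injective n _ _ (cong Edge.hi eq)))

    -- The proofs stored in an edge are irrelevant, so the joining vertex is recovered by a decision
    -- procedure. As `low` values lie below `high` values, the order of the endpoints excludes the
    -- reversed orientation.
    preimage : (e : Edge classGraph) → ∃ (Joins (Edge.lo e) (Edge.hi e))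
    preimage (edge a b a<b a~b) = recompute (joins? a b) (oriented a<b a~b)
      where
      oriented : a < b → classGraph ⊢ a ~ b → ∃ (Joins a b)
      oriented _   (_ , fwd p) = p
      oriented a<b (_ , bwd (v , refl , refl)) = contradiction a<b (<-asym (low<high v v))

    toEdge-preimage : ∀ e → toEdge (proj₁ (preimage e)) ≡ e
    toEdge-preimage e with preimage e
    ... | v , refl , refl = refl

  Krausz⇒lineGraph : IsLineGraphOfBipartite G
  Krausz⇒lineGraph = n + n , classGraph , classGraph-bipartite , record
    { bijection = mk↔ₛ′ toEdge (proj₁ ∘ preimage) toEdge-preimage
                        (λ v → toEdge-injective (toEdge-preimage (toEdge v)))
    ; adjacency = λ u v → mk⇔
        (λ e → (λ eq → ~-irrefl (toEdge-injective eq) e) , meet e)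
        (λ (u≢v , w , w∈u , w∈v) → unmeet u≢v w∈u w∈v)
    }
    where
    meet : ∀ {u v} → u ~ v → ∃ λ w → w isEndOf toEdge u × w isEndOf toEdge v
    meet {u} {v} e with hue u v in eq
    ... | true  = low u  , inj₁ refl , inj₁ (cong (_↑ˡ n) (Class.rep-cong true (inj₂ (e , eq))))
    ... | false = high u , inj₂ refl , inj₂ (cong (n ↑ʳ_) (Class.rep-cong false (inj₂ (e , eq))))

    class⇒adjacent : ∀ {b u v} → toEdge u ≢ toEdge v → SameClass b u v → u ~ v
    class⇒adjacent u≢v (inj₁ refl)    = contradiction refl u≢v
    class⇒adjacent u≢v (inj₂ (e , _)) = e

    unmeet : ∀ {u v w} → toEdge u ≢ toEdge v → w isEndOf toEdge u → w isEndOf toEdge v → u ~ v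
    unmeet u≢v (inj₁ p) (inj₁ q) =
      class⇒adjacent u≢v (Class.rep-injective true (↑ˡ-injective n _ _ (trans (sym p) q)))
    unmeet u≢v (inj₂ p) (inj₂ q) =
      class⇒adjacent u≢v (Class.rep-injective false (↑ʳ-injective n _ _ (trans (sym p) q)))
    unmeet {u} {v} u≢v (inj₁ p) (inj₂ q) = contradiction (trans (sym p) q) (low≢high {u} {v})
    unmeet {u} {v} u≢v (inj₂ p) (inj₁ q) = contradiction (trans (sym q) p) (low≢high {v} {u})

lineGraph⇒Krausz : {G : Graph V} → IsLineGraphOfBipartite G → KrauszColouring G
lineGraph⇒Krausz (_ , _ , bip , φ) = pullback (≅⇒↪ φ) (lineGraph-Krausz bip)

-- Claws, diamonds and odd holes have no Krausz colouring

alternate : (e : ℕ → Bool) (m : ℕ) → (∀ i → suc i ℕ.≤ m * 2 → e i xor e (suc i) ≡ true) →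
            e (m * 2) ≡ e 0
alternate e zero    _   = refl
alternate e (suc m) alt = trans
  (xor-false⇒≡ {e (2 + m * 2)} (twice {e (m * 2)} (alt _ (ℕ.n≤1+n _)) (alt _ ℕ.≤-refl)))
  (alternate e m (λ i i<2m → alt i (ℕ.≤-trans i<2m (ℕ.m≤n+m _ 2))))
  where
  twice : ∀ {x y z} → x xor y ≡ true → y xor z ≡ true → z xor x ≡ false
  twice {true}  {false} {true}  _ _ = refl
  twice {false} {true}  {false} _ _ = refl

-- The three edges at the centre would need pairwise different hues, but there are only two.
claw-no-Krausz : ¬ KrauszColouring claw
claw-no-Krausz K = no-three-distinct {hue 1F 0F} {hue 0F 2F} (turn 10~ 02~ λ ()) (turn 10~ 03~ λ ())
  (subst (λ x → x xor hue 0F 3F ≡ true) (hue-sym 20~) (turn 20~ 03~ λ ()))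
  where
  open KrauszColouring K
  10~ : claw ⊢ 1F ~ 0F
  10~ = toWitness {a? = Graph._~?_ claw 1F 0F} _
  20~ : claw ⊢ 2F ~ 0F
  20~ = toWitness {a? = Graph._~?_ claw 2F 0F} _
  02~ : claw ⊢ 0F ~ 2F
  02~ = toWitness {a? = Graph._~?_ claw 0F 2F} _
  03~ : claw ⊢ 0F ~ 3F
  03~ = toWitness {a? = Graph._~?_ claw 0F 3F} _

  no-three-distinct : ∀ {x y z} → x xor y ≡ true → x xor z ≡ true → ¬ (y xor z ≡ true)
  no-three-distinct {false} {true} {true} _ _ ()
  no-three-distinct {true} {false} {false} _ _ ()

-- The triangles on the edge 23 give 02 and 12 the hue of 23, while the non-adjacency of 0 and 1
-- makes them differ.
diamond-no-Krausz : ¬ KrauszColouring diamond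
diamond-no-Krausz K = xor-true⇒≢ (turn 02~ 21~ λ ())
  (trans (xor-false⇒≡ {hue 0F 2F} (turn 02~ 23~ λ ()))
         (trans (sym (xor-false⇒≡ {hue 1F 2F} (turn 12~ 23~ λ ()))) (hue-sym 12~)))
  where
  open KrauszColouring K
  02~ : diamond ⊢ 0F ~ 2F
  02~ = toWitness {a? = Graph._~?_ diamond 0F 2F} _
  21~ : diamond ⊢ 2F ~ 1F
  21~ = toWitness {a? = Graph._~?_ diamond 2F 1F} _
  12~ : diamond ⊢ 1F ~ 2F
  12~ = toWitness {a? = Graph._~?_ diamond 1F 2F} _
  23~ : diamond ⊢ 2F ~ 3F
  23~ = toWitness {a? = Graph._~?_ diamond 2F 3F} _

-- The relation generating cycle k, on the underlying numbers.
Next : ℕ → ℕ → ℕ → Set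
Next k a b = suc a ≡ b ⊎ (suc a ≡ k × b ≡ 0)

too-small : {_ : False (5 ℕ.≤? k)} → ¬ 5 ≤ k
too-small {_} {p} = toWitnessFalse p

next-irrefl : ∀ {a} → 5 ≤ k → ¬ Next k a a
next-irrefl 5≤k (inj₂ (refl , refl)) = too-small 5≤k

-- Two steps around a cycle with at least five vertices reach neither the start nor a neighbour of
-- it. The cases say which step wraps around.
next² : ∀ {a b c} → 5 ≤ k → Next k a b → Next k b c → a ≢ c × ¬ Next k a c × ¬ Next k c a
next² 5≤k (inj₁ refl) (inj₁ refl) =
  (λ ()) , (λ { (inj₁ ()) ; (inj₂ (_ , ())) }) , λ { (inj₁ ()) ; (inj₂ (refl , refl)) → too-small 5≤k }
next² 5≤k (inj₁ refl) (inj₂ (refl , refl)) =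
  (λ { refl → too-small 5≤k }) , (λ { (inj₁ ()) ; (inj₂ (() , _)) }) ,
  λ { (inj₁ refl) → too-small 5≤k ; (inj₂ (() , _)) }
next² 5≤k (inj₂ (refl , refl)) (inj₁ refl) =
  (λ { refl → too-small 5≤k }) , (λ { (inj₁ refl) → too-small 5≤k ; (inj₂ (_ , ())) }) ,
  λ { (inj₁ refl) → too-small 5≤k ; (inj₂ (refl , _)) → too-small 5≤k }
next² 5≤k (inj₂ (refl , refl)) (inj₂ (refl , refl)) = contradiction 5≤k too-small

module _ (k : ℕ) .{{_ : NonZero k}} (5≤k : 5 ≤ k) where
  private
    toℕ-mod : ∀ i → toℕ (i mod k) ≡ i % k
    toℕ-mod i = toℕ-fromℕ< (m%n<n i k)

    suc-% : ∀ i → suc i % k ≡ suc (i % k) % k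
    suc-% i = trans (cong (λ j → suc j % k) (m≡m%n+[m/n]*n i k)) ([m+kn]%n≡m%n (suc (i % k)) (i / k) k)

    mod-next : ∀ i → Next k (toℕ (i mod k)) (toℕ (suc i mod k))
    mod-next i = subst₂ (Next k) (sym (toℕ-mod i)) (sym (trans (toℕ-mod (suc i)) (suc-% i))) next
      where
      next : Next k (i % k) (suc (i % k) % k)
      next with ℕ.m≤n⇒m<n∨m≡n (m%n<n i k)
      ... | inj₁ <k = inj₁ (sym (m<n⇒m%n≡m <k))
      ... | inj₂ ≡k = inj₂ (≡k , trans (cong (_% k) ≡k) (n%n≡0 k))

    mod-periodic : ∀ i → (i + k) mod k ≡ i mod k
    mod-periodic i =
      toℕ-injective (trans (toℕ-mod (i + k)) (trans ([m+n]%n≡m%n i k) (sym (toℕ-mod i))))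

    step : ∀ i → cycle k ⊢ i mod k ~ suc i mod k
    step i = (λ eq → next-irrefl 5≤k (subst (Next k _) (cong toℕ (sym eq)) (mod-next i))) ,
             fwd (mod-next i)

  -- Hues alternate around the cycle, unrolled to indices in `ℕ`. With `k ≡ suc (m * 2)`, edge
  -- `m * 2` has the hue of edge 0, yet its successor is edge 0 again.
  odd-cycle-no-Krausz : k % 2 ≡ 1 → ¬ KrauszColouring (cycle k)
  odd-cycle-no-Krausz k-odd K = xor-true⇒≢ (alternating (m * 2))
    (trans (alternate side m (λ i _ → alternating i)) (sym closed))
    where
    open KrauszColouring K
    m = k / 2

    k≡1+2m : k ≡ suc (m * 2)
    k≡1+2m = trans (m≡m%n+[m/n]*n k 2) (cong (_+ m * 2) k-odd)

    side : ℕ → Bool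
    side i = hue (i mod k) (suc i mod k)

    alternating : ∀ i → side i xor side (suc i) ≡ true
    alternating i with next² 5≤k (mod-next i) (mod-next (suc i))
    ... | a≢c , ¬ac , ¬ca = trans (turn (step i) (step (suc i)) (a≢c ∘ cong toℕ))
      (cong not (adj-false (cycle k) λ { (_ , fwd r) → ¬ac r ; (_ , bwd r) → ¬ca r }))

    closed : side (suc (m * 2)) ≡ side 0
    closed = subst (λ j → side j ≡ side 0) k≡1+2m (cong₂ hue (mod-periodic 0) (mod-periodic 1))

Krausz⇒avoids : {G : Graph V} → KrauszColouring G → Avoids ClawDiamondOddHole G
Krausz⇒avoids K is-claw    f = claw-no-Krausz (pullback f K)
Krausz⇒avoids K is-diamond f = diamond-no-Krausz (pullback f K)
Krausz⇒avoids K (is-odd-hole {k} 5≤k k-odd) f =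
  odd-cycle-no-Krausz k {{ℕ.>-nonZero (ℕ.≤-trans (s≤s z≤n) 5≤k)}} 5≤k k-odd (pullback f K)

-- Shortest paths between two sets of vertices

-- An induced path that meets `A` and `B` only at its ends. Values of `vertex` beyond `length` are
-- irrelevant.
record Geodesic (G : Graph V) (A B : Pred V 0ℓ) : Set where
  field
    length     : ℕ
    vertex     : ℕ → V
    first      : A (vertex 0)
    last       : B (vertex length)
    only-first : ∀ {i} → i ≤ length → A (vertex i) → i ≡ 0
    only-last  : ∀ {i} → i ≤ length → B (vertex i) → i ≡ length
    step       : ∀ {i} → suc i ≤ length → G ⊢ vertex i ~ vertex (suc i)
    distinct   : ∀ {i j} → i ℕ.< j → j ≤ length → vertex i ≢ vertex j
    chordless  : ∀ {i j} → i ℕ.< j → j ≤ length → G ⊢ vertex i ~ vertex j → j ≡ suc i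

-- A union of components that certifies the absence of a path from `A` to `B`.
record Separation (G : Graph V) (A B : Pred V 0ℓ) : Set where
  field
    part     : V → Bool
    constant : ∀ {u v} → G ⊢ u ~ v → part u ≡ part v
    avoids   : ∀ {u} → A u → part u ≡ false
    contains : ∀ {u} → B u → part u ≡ true

module _ (G : Graph (Fin n)) {A B : Pred (Fin n) 0ℓ} (A? : Decidable A) (B? : Decidable B) where
  open Graph G

  private
    Grows : Subset n → Fin n → Set
    Grows S x = x ∈ S ⊎ ∃ λ y → y ∈ S × y ~ x

    grows? : ∀ S → Decidable (Grows S)
    grows? S x = x ∈? S ⊎-dec any? (λ y → y ∈? S ×-dec y ~? x)

    -- The vertices at distance at most k from B.
    ball : ℕ → Subset n
    ball zero    = select B?
    ball (suc k) = select (grows? (ball k))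

    ball-suc : ∀ k → ball k ⊆ ball (suc k)
    ball-suc k x∈ = ∈-select⁺ (grows? (ball k)) (inj₁ x∈)

    ball-grows : ∀ k {x} → x ∈ ball (suc k) → x ∉ ball k → ∣ ball k ∣ ℕ.< ∣ ball (suc k) ∣
    ball-grows k x∈ x∉ = p⊂q⇒∣p∣<∣q∣ (ball-suc k , _ , x∈ , x∉)

    ball-step : ∀ {k x y} → x ∈ ball k → x ~ y → y ∈ ball (suc k)
    ball-step {k} x∈ x~y = ∈-select⁺ (grows? (ball k)) (inj₂ (_ , x∈ , x~y))

    AtDistance : ℕ → Fin n → Set
    AtDistance k x = x ∈ ball k × ∀ {j} → j ℕ.< k → x ∉ ball j

    distance-≤ : ∀ {i j x} → AtDistance i x → x ∈ ball j → i ≤ j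
    distance-≤ (_ , x∉) x∈ = ℕ.≮⇒≥ λ j<i → x∉ j<i x∈

    distance-unique : ∀ {i j x} → AtDistance i x → AtDistance j x → i ≡ j
    distance-unique p q = ℕ.≤-antisym (distance-≤ p (proj₁ q)) (distance-≤ q (proj₁ p))

    predecessor : ∀ {k x} → AtDistance (suc k) x → ∃ λ y → AtDistance k y × x ~ y
    predecessor {k} (x∈ , x∉) with ∈-select⁻ (grows? (ball k)) x∈
    ... | inj₁ x∈′ = contradiction x∈′ (x∉ ℕ.≤-refl)
    ... | inj₂ (y , y∈ , y~x) =
      y , (y∈ , λ {j} j<k y∈′ → x∉ (s≤s j<k) (ball-step {j} y∈′ y~x)) , ~-sym y~x

    -- Each step moves to a vertex one closer to `B`. The recorded distances later show that the
    -- path is induced.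
    descend : ∀ k x → AtDistance k x →
              Σ (ℕ → Fin n) λ p → p 0 ≡ x × (∀ {i} → i ≤ k → AtDistance (k ∸ i) (p i)) ×
                                  (∀ {i} → suc i ≤ k → p i ~ p (suc i))
    descend zero    x at = (λ _ → x) , refl , (λ { z≤n → at }) , λ ()
    descend (suc k) x at with predecessor at
    ... | y , at′ , x~y with descend k y at′
    ...   | p , refl , p-at , p-step =
      (λ { zero → x ; (suc i) → p i }) , refl ,
      (λ { z≤n → at ; (s≤s i≤k) → p-at i≤k }) ,
      λ { {zero} _ → x~y ; {suc i} (s≤s i<k) → p-step i<k }

    -- Distances to `B` drop by one per step and differ by at most one across an edge, so there are
    -- no repetitions or chords. Minimality of `k` keeps later vertices out of `A`.
    geodesic : ∀ {k x} → (∀ {j y} → j ℕ.< k → A y → y ∉ ball j) → A x → x ∈ ball k → Geodesic G A B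
    geodesic {k} {x} A-far a x∈ with descend k x (x∈ , λ j<k → A-far j<k a)
    ... | p , refl , p-at , p-step = record
      { length     = k
      ; vertex     = p
      ; first      = a
      ; last       = ∈-select⁻ B? (subst (λ j → p k ∈ ball j) (ℕ.n∸n≡0 k) (proj₁ (p-at ℕ.≤-refl)))
      ; only-first = λ { {zero} _ _ → refl
                       ; {suc i} i<k a′ → contradiction (proj₁ (p-at i<k))
                           (A-far (ℕ.∸-monoʳ-< (s≤s z≤n) i<k) a′) }
      ; only-last  = λ {i} i≤k b → ℕ.≤-antisym i≤k
          (ℕ.m∸n≡0⇒m≤n (ℕ.n≤0⇒n≡0 (distance-≤ (p-at i≤k) (∈-select⁺ B? b))))
      ; step       = p-step
      ; distinct   = λ {i} {j} i<j j≤k eq → ℕ.<⇒≢ i<j (ℕ.∸-cancelˡ-≡ (before i<j j≤k) j≤k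
          (distance-unique (p-at (before i<j j≤k)) (subst (AtDistance (k ∸ j)) (sym eq) (p-at j≤k))))
      ; chordless  = λ {i} {j} i<j j≤k e → ℕ.≤-antisym
          (drop (before i<j j≤k) j≤k
            (distance-≤ (p-at (before i<j j≤k)) (ball-step {k ∸ j} (proj₁ (p-at j≤k)) (~-sym e))))
          i<j
      }
      where
      before : ∀ {i j} → i ℕ.< j → j ≤ k → i ≤ k
      before i<j j≤k = ℕ.≤-trans (ℕ.<⇒≤ i<j) j≤k

      drop : ∀ {i j} → i ≤ k → j ≤ k → k ∸ i ≤ suc (k ∸ j) → j ≤ suc i
      drop {i} {j} i≤k j≤k le = ℕ.+-cancelˡ-≤ (k ∸ j) j (suc i) (begin
        (k ∸ j) + j      ≡⟨ ℕ.m∸n+n≡m j≤k ⟩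
        k                ≡⟨ ℕ.m∸n+n≡m i≤k ⟨
        (k ∸ i) + i      ≤⟨ ℕ.+-monoˡ-≤ i le ⟩
        suc (k ∸ j) + i  ≡⟨ ℕ.+-suc (k ∸ j) i ⟨
        (k ∸ j) + suc i  ∎)
        where open ℕ.≤-Reasoning

    -- A ball that is not closed under adjacency grows, so the fuel bounds the search.
    search : ∀ fuel k → n ≤ fuel + ∣ ball k ∣ → (∀ {j y} → j ℕ.< k → A y → y ∉ ball j) →
             Separation G A B ⊎ Geodesic G A B
    search fuel k enough A-far with any? (λ x → A? x ×-dec x ∈? ball k)
    ... | yes (x , a , x∈) = inj₂ (geodesic A-far a x∈)
    ... | no A-far-k with any? (λ x → x ∈? ball (suc k) ×-dec ¬? (x ∈? ball k))
    -- A ball that stops growing is a union of components, and this one contains no vertex of `A`.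
    ...   | no closed = inj₁ record
      { part     = λ x → does (x ∈? ball k)
      ; constant = λ {u} {v} e → does-⇔ (mk⇔ (move e) (move (~-sym e))) (u ∈? ball k) (v ∈? ball k)
      ; avoids   = λ {x} a → dec-false (x ∈? ball k) (λ x∈ → A-far-k (x , a , x∈))
      ; contains = λ {x} b → dec-true (x ∈? ball k) (B⊆ball k b)
      }
      where
      move : ∀ {u v} → u ~ v → u ∈ ball k → v ∈ ball k
      move {v = v} e u∈ = decidable-stable (v ∈? ball k) λ v∉ → closed (v , ball-step {k} u∈ e , v∉)
      B⊆ball : ∀ {x} k → B x → x ∈ ball k
      B⊆ball zero    b = ∈-select⁺ B? b
      B⊆ball (suc k) b = ball-suc k (B⊆ball k b)
    ...   | yes (x , x∈ , x∉) with fuel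
    ...     | zero   = contradiction
      (ℕ.≤-trans (ℕ.≤-trans (ball-grows k x∈ x∉) (∣p∣≤n (ball (suc k)))) enough) (ℕ.<-irrefl refl)
    ...     | suc fuel = search fuel (suc k)
      (ℕ.≤-trans enough (ℕ.≤-trans (ℕ.≤-reflexive (sym (ℕ.+-suc fuel _)))
                                   (ℕ.+-monoʳ-≤ fuel (ball-grows k x∈ x∉))))
      (λ { {j} {y} (s≤s j≤k) a y∈ → case ℕ.m≤n⇒m<n∨m≡n j≤k of λ
             { (inj₁ j<k) → A-far j<k a y∈ ; (inj₂ refl) → A-far-k (y , a , y∈) } })

  separate-or-connect : Separation G A B ⊎ Geodesic G A B
  separate-or-connect = search n 0 (ℕ.m≤m+n n _) (λ ())

-- Extending a Krausz colouring by one vertex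

-- The hues are swapped on whole components, so the two occurrences of `t` in a turn cancel.
recolour : {G : Graph V} (K : KrauszColouring G) (t : V → Bool) →
           (∀ {u v} → G ⊢ u ~ v → t u ≡ t v) → KrauszColouring G
recolour K t t-const = record
  { hue     = λ u v → hue u v xor t u
  ; hue-sym = λ e → cong₂ _xor_ (hue-sym e) (t-const e)
  ; turn    = λ {u} {v} {w} e e′ u≢w →
      trans (cong (λ b → (hue u v xor t u) xor (hue v w xor b)) (sym (t-const e)))
            (trans (cancel (hue u v) (hue v w) (t u)) (turn e e′ u≢w))
  }
  where
  open KrauszColouring K
  cancel : ∀ x y z → (x xor z) xor (y xor z) ≡ x xor y
  cancel false false false = refl
  cancel false false true  = refl
  cancel false true  false = refl
  cancel false true  true  = refl
  cancel true  false false = refl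
  cancel true  false true  = refl
  cancel true  true  false = refl
  cancel true  true  true  = refl

tail : Graph (Fin (suc n)) → Graph (Fin n)
tail G = record
  { _~_      = λ u v → suc u ~ suc v
  ; _~?_     = λ u v → suc u ~? suc v
  ; ~-sym    = ~-sym
  ; ~-irrefl = λ u≡v → ~-irrefl (cong suc u≡v)
  }
  where open Graph G

tail↪ : (G : Graph (Fin (suc n))) → tail G ↪ G
tail↪ G = record
  { embed     = suc
  ; injective = suc-injective
  ; adjacency = λ _ _ → mk⇔ id id
  }

module _ (G : Graph (Fin (suc n))) (K : KrauszColouring (tail G)) where
  open Graph G
  open KrauszColouring K

  -- In a turn of `G`, vertex 0 is in the middle (`at-0`), at one end (`past-0`), or absent, where
  -- `K` applies.
  extend : (side : Fin n → Bool) →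
           (∀ {x y} → 0F ~ suc x → 0F ~ suc y → x ≢ y → side x xor side y ≡ not (adj (tail G) x y)) →
           (∀ {x y} → 0F ~ suc x → suc x ~ suc y → side x xor hue x y ≡ not (adj G 0F (suc y))) →
           KrauszColouring G
  extend side at-0 past-0 = record { hue = hue⁺ ; hue-sym = hue⁺-sym ; turn = turn⁺ }
    where
    hue⁺ : Fin (suc n) → Fin (suc n) → Bool
    -- Arbitrary, since there are no loops.
    hue⁺ zero    zero    = true
    hue⁺ zero    (suc y) = side y
    hue⁺ (suc x) zero    = side x
    hue⁺ (suc x) (suc y) = hue x y

    hue⁺-sym : ∀ {u v} → u ~ v → hue⁺ u v ≡ hue⁺ v u
    hue⁺-sym {zero}  {zero}  _ = refl
    hue⁺-sym {zero}  {suc _} _ = refl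
    hue⁺-sym {suc _} {zero}  _ = refl
    hue⁺-sym {suc _} {suc _} e = hue-sym e

    turn⁺ : ∀ {u v w} → u ~ v → v ~ w → u ≢ w → hue⁺ u v xor hue⁺ v w ≡ not (adj G u w)
    turn⁺ {zero}  {zero}          e e′ u≢w = contradiction e (~-irrefl refl)
    turn⁺ {suc _} {zero}  {zero}  e e′ u≢w = contradiction e′ (~-irrefl refl)
    turn⁺ {zero}  {suc _} {zero}  e e′ u≢w = contradiction refl u≢w
    turn⁺ {suc x} {zero}  {suc y} e e′ u≢w = at-0 (~-sym e) e′ (u≢w ∘ cong suc)
    turn⁺ {zero}  {suc x} {suc y} e e′ u≢w = past-0 e e′
    turn⁺ {suc y} {suc x} {zero}  e e′ u≢w =
      trans (Bool.xor-comm (hue y x) (side x))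
        (trans (cong (side x xor_) (hue-sym e))
          (trans (past-0 (~-sym e′) (~-sym e))
                 (cong not (does-⇔ (mk⇔ ~-sym ~-sym) (0F ~? suc y) (suc y ~? 0F)))))
    turn⁺ {suc x} {suc y} {suc z} e e′ u≢w = turn e e′ (u≢w ∘ cong suc)

module _ {G : Graph V} (avoid : Avoids ClawDiamondOddHole G) where
  open Graph G

  claw-free : ∀ {v a b c} → v ~ a → v ~ b → v ~ c → a ≢ b → a ≢ c → b ≢ c →
              ¬ a ~ b → ¬ a ~ c → b ~ c
  claw-free {v} {a} {b} {c} va vb vc a≢b a≢c b≢c ¬ab ¬ac = decidable-stable (b ~? c) λ ¬bc →
    avoid is-claw (fits⇒↪ {F = claw} (lookup (v ∷ a ∷ b ∷ c ∷ []))
      (pairs₄ (joined! va) (joined! vb) (joined! vc) (apart! a≢b ¬ab) (apart! a≢c ¬ac) (apart! b≢c ¬bc)))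

  diamond-free : ∀ {a b x y} → x ~ y → a ~ x → a ~ y → b ~ x → b ~ y → a ≢ b → a ~ b
  diamond-free {a} {b} {x} {y} xy ax ay bx by a≢b = decidable-stable (a ~? b) λ ¬ab →
    avoid is-diamond (fits⇒↪ {F = diamond} (lookup (a ∷ b ∷ x ∷ y ∷ []))
      (pairs₄ (apart! a≢b ¬ab) (joined! ax) (joined! ay) (joined! bx) (joined! by) (joined! xy)))

halve : ∀ k → ∃ λ m → k ≡ m * 2 ⊎ k ≡ suc (m * 2)
halve zero    = 0 , inj₁ refl
halve (suc k) with halve k
... | m , inj₁ refl = m , inj₂ refl
... | m , inj₂ refl = suc m , inj₁ refl

module _ (G : Graph (Fin (suc n))) (avoid : Avoids ClawDiamondOddHole G)
         (K : KrauszColouring (tail G)) where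
  open Graph G
  open KrauszColouring K

  private
    N : Pred (Fin n) 0ℓ
    N x = 0F ~ suc x

    -- The hue that the edges at x impose on the edge from 0 to x.
    wish : Fin n → Fin n → Bool
    wish x y = hue x y xor not (adj G 0F (suc y))

    wish-inside : ∀ {x y} → N y → wish x y ≡ hue x y
    wish-inside {x} {y} n = trans (cong (λ b → hue x y xor not b) (adj-true G n)) (Bool.xor-identityʳ _)

    wish-outside : ∀ {x y} → ¬ N y → wish x y ≡ not (hue x y)
    wish-outside {x} {y} ¬n =
      trans (cong (λ b → hue x y xor not b) (adj-false G ¬n)) (Bool.xor-comm (hue x y) true)

    -- By `turn` at `x`, the claim is that `y` and `z` are adjacent exactly when both or neither are
    -- neighbours of 0. If neither is, a claw at `x` is excluded; every other case excludes a
    -- diamond.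
    wish-local : ∀ {x y z} → N x → suc x ~ suc y → suc x ~ suc z → wish x y ≡ wish x z
    wish-local {x} {y} {z} Nx xy xz with y ≟ z
    ... | yes refl = refl
    ... | no y≢z   = xor-exchange (hue x y) (hue x z)
      (trans (cong (_xor hue x z) (hue-sym xy)) (trans (turn (~-sym xy) xz y≢z) consistent))
      where
      split : ∀ {y z} → suc x ~ suc y → suc x ~ suc z → N y → ¬ N z → ¬ suc y ~ suc z
      split xy xz Ny ¬Nz yz = ¬Nz (diamond-free avoid xy Nx Ny (~-sym xz) (~-sym yz) λ ())

      consistent : not (adj (tail G) y z) ≡ not (adj G 0F (suc y)) xor not (adj G 0F (suc z))
      consistent with 0F ~? suc y | 0F ~? suc z
      ... | yes Ny | yes Nz = cong not (adj-true (tail G)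
        (diamond-free avoid Nx (~-sym Ny) (~-sym xy) (~-sym Nz) (~-sym xz) (y≢z ∘ suc-injective)))
      ... | yes Ny | no ¬Nz = cong not (adj-false (tail G) (split xy xz Ny ¬Nz))
      ... | no ¬Ny | yes Nz = cong not (adj-false (tail G) (split xz xy Nz ¬Ny ∘ ~-sym))
      ... | no ¬Ny | no ¬Nz = cong not (adj-true (tail G)
        (claw-free avoid (~-sym Nx) xy xz (λ ()) (λ ()) (y≢z ∘ suc-injective) ¬Ny ¬Nz))

    module Clique {Q : Pred (Fin n) 0ℓ} (Q? : Decidable Q) (Q⊆N : ∀ {x} → Q x → N x)
                  (clique : ∀ {x y} → Q x → Q y → x ≢ y → suc x ~ suc y) where

      -- For distinct `x` and `x′`, the edge between them joins two neighbours of 0, so it imposes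
      -- its own hue at both ends.
      wish-agree : ∀ {x y x′ y′} → Q x → Q x′ → suc x ~ suc y → suc x′ ~ suc y′ → wish x y ≡ wish x′ y′
      wish-agree {x} {y} {x′} {y′} q q′ e e′ with x ≟ x′
      ... | yes refl = wish-local (Q⊆N q) e e′
      ... | no x≢x′  = begin
        wish x y    ≡⟨ wish-local (Q⊆N q) e xx′ ⟩
        wish x x′   ≡⟨ wish-inside (Q⊆N q′) ⟩
        hue x x′    ≡⟨ hue-sym xx′ ⟩
        hue x′ x    ≡⟨ wish-inside (Q⊆N q) ⟨
        wish x′ x   ≡⟨ wish-local (Q⊆N q′) (~-sym xx′) e′ ⟩
        wish x′ y′  ∎
        where
        open ≡-Reasoning
        xx′ = clique q q′ x≢x′

      common-wish : ∃ λ α → ∀ {x y} → Q x → suc x ~ suc y → wish x y ≡ α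
      common-wish with any? (λ x → Q? x ×-dec any? (λ y → suc x ~? suc y))
      ... | yes (x , q , y , e) = wish x y , λ q′ e′ → wish-agree q′ q e′ e
      -- No edge of `tail G` meets `Q`, so nothing is imposed and any value serves.
      ... | no none             = true , λ q e → contradiction (_ , q , _ , e) none

    -- The two cliques of neighbours of 0

    module Neighbour (a : Fin n) (Na : N a) where

      Near A B : Pred (Fin n) 0ℓ
      Near x = x ≡ a ⊎ suc x ~ suc a
      A x = N x × Near x
      B x = N x × ¬ Near x

      near? : Decidable Near
      near? x = x ≟ a ⊎-dec suc x ~? suc a

      A? : Decidable A
      A? x = 0F ~? suc x ×-dec near? x

      B? : Decidable B
      B? x = 0F ~? suc x ×-dec ¬? (near? x)

      -- Two vertices adjacent to both 0 and `a` are adjacent, or they would form a diamond on the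
      -- edge from 0 to `a`.
      A-clique : ∀ {x y} → A x → A y → x ≢ y → suc x ~ suc y
      A-clique (_ , inj₁ refl) (_ , inj₁ refl) x≢y = contradiction refl x≢y
      A-clique (_ , inj₁ refl) (_ , inj₂ ya)   x≢y = ~-sym ya
      A-clique (_ , inj₂ xa)   (_ , inj₁ refl) x≢y = xa
      A-clique (Nx , inj₂ xa)  (Ny , inj₂ ya)  x≢y =
        diamond-free avoid Na (~-sym Nx) xa (~-sym Ny) ya (x≢y ∘ suc-injective)

      -- Otherwise 0 would be the centre of a claw with leaves `a`, `x` and `y`.
      B-clique : ∀ {x y} → B x → B y → x ≢ y → suc x ~ suc y
      B-clique (Nx , ¬x) (Ny , ¬y) x≢y =
        claw-free avoid Na Nx Ny (¬x ∘ inj₁ ∘ sym ∘ suc-injective) (¬y ∘ inj₁ ∘ sym ∘ suc-injective)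
          (x≢y ∘ suc-injective) (¬x ∘ inj₂ ∘ ~-sym) (¬y ∘ inj₂ ∘ ~-sym)

      -- If `x` is not `a`, then `a` and `y` would both form triangles with the edge from 0 to `x`,
      -- making `y` adjacent to `a`.
      A-B-nonadjacent : ∀ {x y} → A x → B y → ¬ suc x ~ suc y
      A-B-nonadjacent (_ , inj₁ refl) (_ , ¬y)  xy = ¬y (inj₂ (~-sym xy))
      A-B-nonadjacent (Nx , inj₂ xa)  (Ny , ¬y) xy =
        ¬y (inj₂ (diamond-free avoid Nx (~-sym Ny) (~-sym xy) (~-sym Na) (~-sym xa)
                   (¬y ∘ inj₁ ∘ suc-injective)))

      module InA = Clique A? proj₁ A-clique
      module InB = Clique B? proj₁ B-clique

      α β : Bool
      α = proj₁ InA.common-wish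
      β = proj₁ InB.common-wish

      -- Edges from 0 get hue `true` towards `A` and `false` towards `B`. Recolouring by `t` adds
      -- `t` to the wishes, so it must be `not α` on `A` and `β` on `B`.
      finish : (t : Fin n → Bool) → (∀ {x y} → suc x ~ suc y → t x ≡ t y) →
               (∀ {x} → A x → t x ≡ not α) → (∀ {x} → B x → t x ≡ β) → KrauszColouring G
      finish t t-const t-A t-B = extend G (recolour K t t-const) (does ∘ near?)
        (λ {x} {y} → at-0 (near? x) (near? y)) (λ {x} → past-0 (near? x))
        where
        at-0 : ∀ {x y} (x? : Dec (Near x)) (y? : Dec (Near y)) → N x → N y → x ≢ y →
               does x? xor does y? ≡ not (adj (tail G) x y)
        at-0 (yes p) (yes q) Nx Ny x≢y =
          cong not (sym (adj-true (tail G) (A-clique (Nx , p) (Ny , q) x≢y)))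
        at-0 (no ¬p) (no ¬q) Nx Ny x≢y =
          cong not (sym (adj-true (tail G) (B-clique (Nx , ¬p) (Ny , ¬q) x≢y)))
        at-0 (yes p) (no ¬q) Nx Ny _   =
          cong not (sym (adj-false (tail G) (A-B-nonadjacent (Nx , p) (Ny , ¬q))))
        at-0 (no ¬p) (yes q) Nx Ny _   =
          cong not (sym (adj-false (tail G) (A-B-nonadjacent (Ny , q) (Nx , ¬p) ∘ ~-sym)))

        solve-A : ∀ p q {r t} → p xor q ≡ r → t ≡ not r → true xor (p xor t) ≡ q
        solve-A false false refl refl = refl
        solve-A false true  refl refl = refl
        solve-A true  false refl refl = refl
        solve-A true  true  refl refl = refl

        solve-B : ∀ p q {r t} → p xor q ≡ r → t ≡ r → p xor t ≡ q
        solve-B false _     refl refl = refl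
        solve-B true  false refl refl = refl
        solve-B true  true  refl refl = refl

        past-0 : ∀ {x y} (x? : Dec (Near x)) → N x → suc x ~ suc y →
                 does x? xor (hue x y xor t x) ≡ not (adj G 0F (suc y))
        past-0 {x} {y} (yes p) Nx e =
          solve-A (hue x y) _ (proj₂ InA.common-wish (Nx , p) e) (t-A (Nx , p))
        past-0 {x} {y} (no ¬p) Nx e =
          solve-B (hue x y) _ (proj₂ InB.common-wish (Nx , ¬p) e) (t-B (Nx , ¬p))

      module Connected (γ : Geodesic (tail G) A B) where
        open Geodesic γ

        -- Vertex 0 closes the path: inner vertices are outside `A` and `B`, hence no neighbours of
        -- 0.
        hole : cycle (2 + length) ↪ G
        hole = fits⇒↪ f fits
          where
          C = cycle (2 + length)

          f : Fin (2 + length) → Fin (suc n)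
          f zero    = 0F
          f (suc i) = suc (vertex (toℕ i))

          ≤length : (i : Fin (suc length)) → toℕ i ≤ length
          ≤length i = ℕ.s≤s⁻¹ (toℕ<n i)

          fits : ∀ i j → i < j → Fits C G f i j
          fits zero (suc j) _ with toℕ j ℕ.≟ 0 | toℕ j ℕ.≟ length
          ... | yes j≡0 | _ = joined ((λ ()) , fwd (inj₁ (cong suc (sym j≡0))))
            (subst (N ∘ vertex) (sym j≡0) (proj₁ first))
          ... | no _ | yes j≡l = joined ((λ ()) , bwd (inj₂ (cong (2 +_) j≡l , refl)))
            (subst (N ∘ vertex) (sym j≡l) (proj₁ last))
          ... | no j≢0 | no j≢l = apart
            (λ { (_ , fwd (inj₁ eq)) → j≢0 (sym (ℕ.suc-injective eq))
               ; (_ , bwd (inj₂ (eq , _))) → j≢l (ℕ.suc-injective (ℕ.suc-injective eq)) })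
            (λ ())
            (λ Nj → case near? (vertex (toℕ j)) of λ
               { (yes p) → j≢0 (only-first (≤length j) (Nj , p))
               ; (no ¬p) → j≢l (only-last (≤length j) (Nj , ¬p)) })
          fits (suc i) (suc j) (s≤s i<j) with toℕ j ℕ.≟ suc (toℕ i)
          ... | yes j≡1+i = joined
            ((λ eq → ℕ.<-irrefl (cong toℕ (suc-injective eq)) i<j) , fwd (inj₁ (cong suc (sym j≡1+i))))
            (subst (λ l → suc (vertex (toℕ i)) ~ suc (vertex l)) (sym j≡1+i)
                   (step (subst (_≤ length) j≡1+i (≤length j))))
          ... | no j≢1+i = apart
            (λ { (_ , fwd (inj₁ eq)) → j≢1+i (sym (ℕ.suc-injective eq))
               ; (_ , bwd (inj₁ eq)) → ℕ.<-asym i<j (ℕ.≤-reflexive (ℕ.suc-injective eq)) })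
            (distinct i<j (≤length j) ∘ suc-injective)
            (j≢1+i ∘ chordless i<j (≤length j))

        edge-hue : ℕ → Bool
        edge-hue i = hue (vertex i) (vertex (suc i))

        alternating : ∀ i → 2 + i ≤ length → edge-hue i xor edge-hue (suc i) ≡ true
        alternating i le = trans
          (turn (step (ℕ.<⇒≤ le)) (step le) (distinct (ℕ.n≤1+n (suc i)) le))
          (cong not (adj-false (tail G) λ e →
            ℕ.<-irrefl (sym (chordless (ℕ.n≤1+n (suc i)) le e)) ℕ.≤-refl))

        -- The geodesic leaves A and enters B along edges to non-neighbours of 0.
        opposite-wishes : ∀ m → length ≡ 2 + m * 2 → not α ≡ β
        opposite-wishes m refl = begin
          not α
            ≡⟨ cong not (proj₂ InA.common-wish first (step (s≤s z≤n))) ⟨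
          not (wish (vertex 0) (vertex 1))
            ≡⟨ cong not (wish-outside (inner (s≤s z≤n) (s≤s (s≤s z≤n)))) ⟩
          not (not (edge-hue 0))
            -- Edges 0 and `m * 2` agree, and the last edge, `suc (m * 2)`, alternates once more.
            ≡⟨ cong (not ∘ not) (alternate edge-hue m alternates) ⟨
          not (not (edge-hue (m * 2)))
            ≡⟨ cong not (xor-true⇒≡not (alternating (m * 2) ℕ.≤-refl)) ⟨
          not (edge-hue (suc (m * 2)))
            ≡⟨ cong not (hue-sym (step ℕ.≤-refl)) ⟩
          not (hue (vertex (2 + m * 2)) (vertex (suc (m * 2))))
            ≡⟨ wish-outside (inner (s≤s z≤n) ℕ.≤-refl) ⟨
          wish (vertex (2 + m * 2)) (vertex (suc (m * 2)))
            ≡⟨ proj₂ InB.common-wish last (~-sym (step ℕ.≤-refl)) ⟩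
          β ∎
          where
          open ≡-Reasoning
          alternates : ∀ i → suc i ≤ m * 2 → edge-hue i xor edge-hue (suc i) ≡ true
          alternates i i<2m = alternating i (s≤s (ℕ.m≤n⇒m≤1+n i<2m))
          inner : ∀ {i} → 0 ℕ.< i → i ℕ.< length → ¬ N (vertex i)
          inner {i} 0<i i<l Ni with near? (vertex i)
          ... | yes p = ℕ.<⇒≢ 0<i (sym (only-first (ℕ.<⇒≤ i<l) (Ni , p)))
          ... | no ¬p = ℕ.<⇒≢ i<l (only-last (ℕ.<⇒≤ i<l) (Ni , ¬p))

        -- Length 0 contradicts the disjointness of `A` and `B`, and length 1 the absence of edges
        -- between them. A larger odd length gives an odd hole on at least five vertices, which
        -- leaves the even lengths from 2 on.
        compatible : not α ≡ β
        compatible with halve length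
        ... | zero  , inj₁ l≡0 = contradiction (proj₂ first) (proj₂ (subst (B ∘ vertex) l≡0 last))
        ... | suc m , inj₁ l≡  = opposite-wishes m l≡
        ... | zero  , inj₂ l≡1 = contradiction (step (ℕ.≤-reflexive (sym l≡1)))
          (A-B-nonadjacent first (subst (B ∘ vertex) l≡1 last))
        ... | suc m , inj₂ l≡  = contradiction hole
          (avoid (is-odd-hole (subst (λ l → 5 ≤ 2 + l) (sym l≡) (ℕ.m≤m+n 5 (m * 2)))
                              (trans (cong (λ l → (2 + l) % 2) l≡) ([m+kn]%n≡m%n 1 (2 + m) 2))))

      -- Separated parts can be recoloured independently, as `A` and `B` demand. Otherwise
      -- `compatible` lets one constant meet both demands.
      add-vertex : KrauszColouring G
      add-vertex with separate-or-connect (tail G) A? B?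
      ... | inj₁ σ = finish (λ x → if part x then β else not α)
        (λ e → cong (if_then β else not α) (constant e))
        (λ a → cong (if_then β else not α) (avoids a))
        (λ b → cong (if_then β else not α) (contains b))
        where open Separation σ
      ... | inj₂ γ = finish (λ _ → β) (λ _ → refl) (λ _ → sym (Connected.compatible γ)) (λ _ → refl)

  Krausz-suc : KrauszColouring G
  Krausz-suc with any? (λ x → 0F ~? suc x)
  ... | yes (a , Na) = Neighbour.add-vertex a Na
  ... | no isolated  = extend G K (λ _ → true) (λ Nx → contradiction (_ , Nx) isolated)
                                               (λ Nx → contradiction (_ , Nx) isolated)

avoids⇒Krausz : (G : Graph (Fin n)) → Avoids ClawDiamondOddHole G → KrauszColouring G
avoids⇒Krausz {zero}  G avoid = record { hue = λ () ; hue-sym = λ { {()} } ; turn = λ { {()} } }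
avoids⇒Krausz {suc n} G avoid =
  Krausz-suc G avoid (avoids⇒Krausz (tail G) (λ F∈ f → avoid F∈ (↪-trans f (tail↪ G))))

proposition15 : (n : ℕ) (G : Graph (Fin n)) →
    ((∃ λ (c : EdgeColouring G) → Freeᶜ Patterns c) ⇔ IsLineGraphOfBipartite G)
    × (IsLineGraphOfBipartite G ⇔ Free ClawDiamondOddHole G)
proposition15 n G = mk⇔ colouring⇒line line⇒colouring , mk⇔ line⇒free free⇒line
  where
  colouring⇒line : (∃ λ (c : EdgeColouring G) → Freeᶜ Patterns c) → IsLineGraphOfBipartite G
  colouring⇒line (c , free) = Krausz⇒lineGraph (pattern-free⇒Krausz c free)

  line⇒colouring : IsLineGraphOfBipartite G → ∃ λ (c : EdgeColouring G) → Freeᶜ Patterns c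
  line⇒colouring line = edgeColouring K , edgeColouring-free K
    where
    K : KrauszColouring G
    K = lineGraph⇒Krausz line

  line⇒free : IsLineGraphOfBipartite G → Free ClawDiamondOddHole G
  line⇒free line = Avoids⇒Free {𝓕 = ClawDiamondOddHole} (Krausz⇒avoids (lineGraph⇒Krausz line))

  free⇒line : Free ClawDiamondOddHole G → IsLineGraphOfBipartite G
  free⇒line free = Krausz⇒lineGraph (avoids⇒Krausz G (Free⇒Avoids {𝓕 = ClawDiamondOddHole} free))
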